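{- Let $s_l=(a_j)$, $1\le j\le l$, be an ordered string of non-negative integers and let $k=\max\{a_j:1\le j\le l\}$. Then the Kyle graph associated with $s_l$ is constructed on $n=2k+1$ vertices, i.e. it is $O_{2k+1}(s_l)$, and it attains the maximum possible degree $\Delta(O_{2k+1}(s_l))=2\sum_{j=1}^{l}a_j$ at a single vertex.
   Context: An ordered string $s_l=(a_j)$, $1\le j\le l$ ($l\ge 1$), is an $l$-tuple of non-negative integers; $j$ is the index of the entry $a_j$. For a positive integer $n$, the ornated graph $O_n(s_l)$ is the (in general non-simple) directed graph on vertices $v_1,\dots,v_n$ whose arcs, counted with multiplicity, are the following: each odd-indexed entry $a_t$ contributes one arc $(v_i,v_j)$ for every pair $i<j$ with $i+a_t\ge j$; each even-indexed entry $a_s$ contributes one arc $(v_i,v_j)$ for every pair $i>j$ with $i-a_s\le j$. The degree of a vertex is $d(v)=d^+(v)+d^-(v)$ (out-degree plus in-degree, with multiplicity), and $\Delta(O_n(s_l))$ is the maximum degree. The maximum possible degree associated with $s_l$ is $\max_{n\ge 1}\Delta(O_n(s_l))$. The Kyle graph associated with $s_l$ is the ornated graph $O_n(s_l)$ of smallest order $n$ that has a vertex of this maximum possible degree. -}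

module Defs where

import Algebra.Properties.CommutativeMonoid.Sum
open import Data.Bool.Base using (if_then_else_)
open import Data.Fin.Base using (Fin; toℕ)
open import Data.Nat.Base using (ℕ; suc; _+_; _∸_; _⊔_; _≤_; _<_; NonZero; parity)
open import Data.Nat.Properties using (+-0-commutativeMonoid; _≤?_; _<?_)
open import Data.Parity.Base using (0ℙ; 1ℙ)
open import Data.Parity.Properties using () renaming (_≟_ to _≟ℙ_)
open import Data.Product.Base using (_×_; ∃-syntax)
open import Data.Sum.Base using (_⊎_)
open import Data.Vec.Functional using (Vector; foldr)
open import Relation.Binary.PropositionalEquality.Core using (_≡_)
open import Relation.Nullary.Decidable.Core using (Dec; does; _×-dec_; _⊎-dec_)

open Algebra.Properties.CommutativeMonoid.Sum +-0-commutativeMonoid public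
  using (sum; sum-syntax)

maximum : ∀ {n} → Vector ℕ n → ℕ
maximum = foldr _⊔_ 0

record MultiDigraph (n : ℕ) : Set where
  constructor mkMultiDigraph
  field
    -- number of arcs from the first vertex to the second
    arcs : Fin n → Fin n → ℕ

open MultiDigraph public

module _ {n : ℕ} (G : MultiDigraph n) where

  outDegree inDegree degree : Fin n → ℕ
  outDegree v = ∑[ w < n ] arcs G v w
  inDegree  v = ∑[ w < n ] arcs G w v
  degree    v = outDegree v + inDegree v

  Δ : ℕ
  Δ = maximum degree

-- Ordered strings of length l ≥ 1; the bound on l is imposed where strings are
-- quantified over.
OrderedString : ℕ → Set
OrderedString l = Vector ℕ l

-- The entry of index t contributes an arc from v_i to v_j.  Indices of entries
-- start at 1, hence the parity of suc (toℕ t).  Numbering the vertices from 0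
-- is harmless, because the conditions are invariant under a shift of i and j;
-- so is the truncation of i ∸ s t, because j is non-negative.
Contributes : ∀ {l n} → OrderedString l → Fin l → Fin n → Fin n → Set
Contributes s t i j =
    (parity (suc (toℕ t)) ≡ 1ℙ × toℕ i < toℕ j × toℕ j ≤ toℕ i + s t)
  ⊎ (parity (suc (toℕ t)) ≡ 0ℙ × toℕ j < toℕ i × toℕ i ∸ s t ≤ toℕ j)

contributes? : ∀ {l n} (s : OrderedString l) (t : Fin l) (i j : Fin n) →
               Dec (Contributes s t i j)
contributes? s t i j =
    ((parity (suc (toℕ t)) ≟ℙ 1ℙ) ×-dec (toℕ i <? toℕ j) ×-dec (toℕ j ≤? toℕ i + s t))
  ⊎-dec
    ((parity (suc (toℕ t)) ≟ℙ 0ℙ) ×-dec (toℕ j <? toℕ i) ×-dec (toℕ i ∸ s t ≤? toℕ j))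

O : ∀ {l} (n : ℕ) → OrderedString l → MultiDigraph n
O {l} n s = mkMultiDigraph λ i j →
  ∑[ t < l ] (if does (contributes? s t i j) then 1 else 0)

-- D is the maximum of Δ (O n s) over all n ≥ 1.
record IsMaximumPossibleDegree {l} (s : OrderedString l) (D : ℕ) : Set where
  field
    attained   : ∃[ n ] (NonZero n × Δ (O n s) ≡ D)
    upperBound : ∀ n → NonZero n → Δ (O n s) ≤ D

HasVertexOfDegree : ∀ {n} → MultiDigraph n → ℕ → Set
HasVertexOfDegree G D = ∃[ v ] degree G v ≡ D

-- Orders are automatically positive here, since a vertex is exhibited.
record IsKyleGraph {l} (s : OrderedString l) {n} (G : MultiDigraph n) : Set where
  field
    isOrnated     : G ≡ O n s
    maxDegree     : ℕ
    isMaximum     : IsMaximumPossibleDegree s maxDegree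
    hasVertex     : HasVertexOfDegree G maxDegree
    smallestOrder : ∀ m → HasVertexOfDegree (O m s) maxDegree → n ≤ m

{-# OPTIONS --safe #-}

-- An entry a contributes to the degree of v one unit for each vertex at
-- distance at most a to the left of v, and one for each such vertex to its
-- right: both parities give the same neighbours and only swap the roles of
-- in- and out-arcs.  With p vertices to the left of v and q to its right, the
-- degree is therefore Σ (min(a_j, p) + min(a_j, q)) ≤ 2 Σ a_j, with equality
-- iff k ≤ p and k ≤ q.  Since p + q + 1 = n, this forces n ≥ 2k + 1, and for
-- n = 2k + 1 it singles out the central vertex p = q = k.
module Submission where

open import Defs
open import Data.Bool.Base using (if_then_else_)
open import Data.Fin.Base using (Fin; zero; suc; toℕ; fromℕ<; opposite)
open import Data.Fin.Properties
  using (toℕ<n; toℕ-fromℕ; toℕ-fromℕ<; toℕ-injective; opposite-prop; opposite-suc)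
open import Data.Nat.Base
open import Data.Nat.Properties
open import Data.Parity.Base using (0ℙ; 1ℙ)
open import Data.Product using (_×_; ∃!; _,_; proj₁; proj₂)
open import Data.Sum.Base using (inj₁; inj₂)
open import Data.Vec.Functional using (Vector)
open import Function.Base using (_∘_)
open import Function.Bundles using (_⇔_; mk⇔)
open import Relation.Binary.PropositionalEquality
  using (_≡_; refl; sym; trans; cong; cong₂; subst; _≗_; module ≡-Reasoning)
open import Relation.Nullary.Decidable using (Dec; does; does-⇔; _×-dec_)
import Algebra.Properties.CommutativeMonoid.Sum +-0-commutativeMonoid as Sum

+-tight-≤ : ∀ {a b c d} → a ≤ b → c ≤ d → a + c ≡ b + d → a ≡ b × c ≡ d
+-tight-≤ {a} {b} {c} {d} a≤b c≤d eq =
  ≤-antisym a≤b (+-cancelʳ-≤ d b a (≤-trans (≤-reflexive (sym eq)) (+-monoʳ-≤ a c≤d))) ,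
  ≤-antisym c≤d (+-cancelˡ-≤ b d c (≤-trans (≤-reflexive (sym eq)) (+-monoˡ-≤ c a≤b)))

sum-mono-≤ : ∀ {n} {f g : Vector ℕ n} → (∀ i → f i ≤ g i) → sum f ≤ sum g
sum-mono-≤ {zero}  f≤g = z≤n
sum-mono-≤ {suc n} f≤g = +-mono-≤ (f≤g zero) (sum-mono-≤ (f≤g ∘ suc))

sum-tight-≤ : ∀ {n} {f g : Vector ℕ n} → (∀ i → f i ≤ g i) → sum f ≡ sum g → f ≗ g
sum-tight-≤ f≤g eq zero    = proj₁ (+-tight-≤ (f≤g zero) (sum-mono-≤ (f≤g ∘ suc)) eq)
sum-tight-≤ f≤g eq (suc i) =
  sum-tight-≤ (f≤g ∘ suc) (proj₂ (+-tight-≤ (f≤g zero) (sum-mono-≤ (f≤g ∘ suc)) eq)) i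

2*sum : ∀ {n} (f : Vector ℕ n) → ∑[ i < n ] (f i + f i) ≡ 2 * sum f
2*sum f = trans (Sum.∑-distrib-+ f f) (cong (sum f +_) (sym (+-identityʳ (sum f))))

≤maximum : ∀ {n} (f : Vector ℕ n) i → f i ≤ maximum f
≤maximum f zero    = m≤m⊔n _ _
≤maximum f (suc i) = ≤-trans (≤maximum (f ∘ suc) i) (m≤n⊔m _ _)

maximum-lub : ∀ {n} (f : Vector ℕ n) {m} → (∀ i → f i ≤ m) → maximum f ≤ m
maximum-lub {zero}  f f≤m = z≤n
maximum-lub {suc n} f f≤m = ⊔-lub (f≤m zero) (maximum-lub (f ∘ suc) (f≤m ∘ suc))

private variable
  P Q : Set

𝟙 : Dec P → ℕ
𝟙 P? = if does P? then 1 else 0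

𝟙-cong : P ⇔ Q → (P? : Dec P) (Q? : Dec Q) → 𝟙 P? ≡ 𝟙 Q?
𝟙-cong P⇔Q P? Q? = cong (if_then 1 else 0) (does-⇔ P⇔Q P? Q?)

Within : ℕ → ℕ → ℕ → Set
Within a i j = i < j × j ≤ i + a

within? : ∀ a i j → Dec (Within a i j)
within? a i j = (i <? j) ×-dec (j ≤? i + a)

within-suc : ∀ a i j → 𝟙 (within? a (suc i) (suc j)) ≡ 𝟙 (within? a i j)
within-suc a i j = 𝟙-cong
  (mk⇔ (λ (i<j , j≤i+a) → s<s⁻¹ i<j , s≤s⁻¹ j≤i+a) (λ (i<j , j≤i+a) → s<s i<j , s≤s j≤i+a))
  (within? a (suc i) (suc j)) (within? a i j)

count-< : ∀ a n → ∑[ w < n ] 𝟙 (toℕ w <? a) ≡ a ⊓ n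
count-< zero    zero    = refl
count-< zero    (suc n) = count-< zero n
count-< (suc a) zero    = refl
count-< (suc a) (suc n) = cong suc (count-< a n)

⊓-suc : ∀ a m → 𝟙 (m <? a) + a ⊓ m ≡ a ⊓ suc m
⊓-suc zero          m       = refl
⊓-suc (suc zero)    zero    = refl
⊓-suc (suc (suc a)) zero    = refl
⊓-suc (suc a)       (suc m) = trans (+-suc _ _) (cong suc (⊓-suc a m))

count-right : ∀ a {n} (v : Fin n) →
              ∑[ w < n ] 𝟙 (within? a (toℕ v) (toℕ w)) ≡ a ⊓ toℕ (opposite v)
count-right a {suc n} zero    = trans (count-< a n) (cong (a ⊓_) (sym (toℕ-fromℕ n)))
count-right a {suc n} (suc v) = begin
  ∑[ w < n ] 𝟙 (within? a (suc (toℕ v)) (suc (toℕ w)))  ≡⟨ Sum.sum-cong-≗ {n} (λ w → within-suc a (toℕ v) (toℕ w)) ⟩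
  ∑[ w < n ] 𝟙 (within? a (toℕ v) (toℕ w))              ≡⟨ count-right a v ⟩
  a ⊓ toℕ (opposite v)                                  ≡⟨ cong (a ⊓_) (opposite-suc v) ⟨
  a ⊓ toℕ (opposite (suc v))                            ∎
  where open ≡-Reasoning

count-left : ∀ a {n} (v : Fin n) →
             ∑[ w < n ] 𝟙 (within? a (toℕ w) (toℕ v)) ≡ a ⊓ toℕ v
count-left a {suc n} zero    = trans (Sum.sum-replicate-zero n) (sym (⊓-zeroʳ a))
count-left a {suc n} (suc v) = begin
  𝟙 (toℕ v <? a) + ∑[ w < n ] 𝟙 (within? a (suc (toℕ w)) (suc (toℕ v)))  ≡⟨ cong (𝟙 (toℕ v <? a) +_) (Sum.sum-cong-≗ {n} (λ w → within-suc a (toℕ w) (toℕ v))) ⟩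
  𝟙 (toℕ v <? a) + ∑[ w < n ] 𝟙 (within? a (toℕ w) (toℕ v))              ≡⟨ cong (𝟙 (toℕ v <? a) +_) (count-left a v) ⟩
  𝟙 (toℕ v <? a) + a ⊓ toℕ v                                             ≡⟨ ⊓-suc a (toℕ v) ⟩
  a ⊓ suc (toℕ v)                                                        ∎
  where open ≡-Reasoning

module _ {l} (s : OrderedString l) where

  contributes-odd : ∀ {n} t → parity (suc (toℕ t)) ≡ 1ℙ → (i j : Fin n) →
                    𝟙 (contributes? s t i j) ≡ 𝟙 (within? (s t) (toℕ i) (toℕ j))
  contributes-odd t odd i j = 𝟙-cong (mk⇔ to (λ p → inj₁ (odd , p)))
    (contributes? s t i j) (within? (s t) (toℕ i) (toℕ j))
    where
    to : Contributes s t i j → Within (s t) (toℕ i) (toℕ j)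
    to (inj₁ (_ , p)) = p
    to (inj₂ (even , _)) with () ← trans (sym odd) even

  contributes-even : ∀ {n} t → parity (suc (toℕ t)) ≡ 0ℙ → (i j : Fin n) →
                     𝟙 (contributes? s t i j) ≡ 𝟙 (within? (s t) (toℕ j) (toℕ i))
  contributes-even t even i j = 𝟙-cong (mk⇔ to from)
    (contributes? s t i j) (within? (s t) (toℕ j) (toℕ i))
    where
    to : Contributes s t i j → Within (s t) (toℕ j) (toℕ i)
    to (inj₁ (odd , _)) with () ← trans (sym odd) even
    to (inj₂ (_ , j<i , i∸a≤j)) = j<i , (begin
      toℕ i                  ≤⟨ m≤n+m∸n (toℕ i) (s t) ⟩
      s t + (toℕ i ∸ s t)    ≤⟨ +-monoʳ-≤ (s t) i∸a≤j ⟩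
      s t + toℕ j            ≡⟨ +-comm (s t) (toℕ j) ⟩
      toℕ j + s t            ∎)
      where open ≤-Reasoning
    from : Within (s t) (toℕ j) (toℕ i) → Contributes s t i j
    from (j<i , i≤j+a) =
      inj₂ (even , j<i , m≤n+o⇒m∸n≤o (toℕ i) (s t) (subst (toℕ i ≤_) (+-comm (toℕ j) (s t)) i≤j+a))

  entry-degree : ∀ {n} t (v : Fin n) →
                 ∑[ w < n ] 𝟙 (contributes? s t v w) + ∑[ w < n ] 𝟙 (contributes? s t w v)
                 ≡ s t ⊓ toℕ v + s t ⊓ toℕ (opposite v)
  entry-degree {n} t v = by-parity _ refl
    where
    by-parity : ∀ p → parity (suc (toℕ t)) ≡ p →
                ∑[ w < n ] 𝟙 (contributes? s t v w) + ∑[ w < n ] 𝟙 (contributes? s t w v)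
                ≡ s t ⊓ toℕ v + s t ⊓ toℕ (opposite v)
    by-parity 1ℙ odd = trans
      (cong₂ _+_
        (trans (Sum.sum-cong-≗ {n} (λ w → contributes-odd t odd v w)) (count-right (s t) v))
        (trans (Sum.sum-cong-≗ {n} (λ w → contributes-odd t odd w v)) (count-left (s t) v)))
      (+-comm (s t ⊓ toℕ (opposite v)) _)
    by-parity 0ℙ even = cong₂ _+_
      (trans (Sum.sum-cong-≗ {n} (λ w → contributes-even t even v w)) (count-left (s t) v))
      (trans (Sum.sum-cong-≗ {n} (λ w → contributes-even t even w v)) (count-right (s t) v))

  degree-O : ∀ {n} (v : Fin n) →
             degree (O n s) v ≡ ∑[ t < l ] (s t ⊓ toℕ v + s t ⊓ toℕ (opposite v))
  degree-O {n} v = begin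
    ∑[ w < n ] ∑[ t < l ] 𝟙 (contributes? s t v w) + ∑[ w < n ] ∑[ t < l ] 𝟙 (contributes? s t w v)
      ≡⟨ cong₂ _+_ (Sum.∑-comm {n} {l} (λ w t → 𝟙 (contributes? s t v w)))
                   (Sum.∑-comm {n} {l} (λ w t → 𝟙 (contributes? s t w v))) ⟩
    ∑[ t < l ] ∑[ w < n ] 𝟙 (contributes? s t v w) + ∑[ t < l ] ∑[ w < n ] 𝟙 (contributes? s t w v)
      ≡⟨ Sum.∑-distrib-+ (λ t → ∑[ w < n ] 𝟙 (contributes? s t v w)) _ ⟨
    ∑[ t < l ] (∑[ w < n ] 𝟙 (contributes? s t v w) + ∑[ w < n ] 𝟙 (contributes? s t w v))
      ≡⟨ Sum.sum-cong-≗ {l} (λ t → entry-degree t v) ⟩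
    ∑[ t < l ] (s t ⊓ toℕ v + s t ⊓ toℕ (opposite v))
      ∎
    where open ≡-Reasoning

  private
    k D : ℕ
    k = maximum s
    D = 2 * sum s

  truncated≤ : ∀ p q t → s t ⊓ p + s t ⊓ q ≤ s t + s t
  truncated≤ p q t = +-mono-≤ (m⊓n≤m (s t) p) (m⊓n≤m (s t) q)

  degree≤D : ∀ {n} (v : Fin n) → degree (O n s) v ≤ D
  degree≤D {n} v = begin
    degree (O n s) v                                   ≡⟨ degree-O v ⟩
    ∑[ t < l ] (s t ⊓ toℕ v + s t ⊓ toℕ (opposite v))  ≤⟨ sum-mono-≤ (truncated≤ _ _) ⟩
    ∑[ t < l ] (s t + s t)                             ≡⟨ 2*sum s ⟩
    D                                                  ∎
    where open ≤-Reasoning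

  degree≡D : ∀ {n} (v : Fin n) → k ≤ toℕ v → k ≤ toℕ (opposite v) → degree (O n s) v ≡ D
  degree≡D v k≤left k≤right = trans (degree-O v) (trans
    (Sum.sum-cong-≗ {l} (λ t → cong₂ _+_
      (m≤n⇒m⊓n≡m (≤-trans (≤maximum s t) k≤left))
      (m≤n⇒m⊓n≡m (≤-trans (≤maximum s t) k≤right))))
    (2*sum s))

  degree≡D⁻¹ : ∀ {n} (v : Fin n) → degree (O n s) v ≡ D → k ≤ toℕ v × k ≤ toℕ (opposite v)
  degree≡D⁻¹ v deg≡D =
    maximum-lub s (λ t → m⊓n≡m⇒m≤n (proj₁ (both t))) ,
    maximum-lub s (λ t → m⊓n≡m⇒m≤n (proj₂ (both t)))
    where
    both : ∀ t → s t ⊓ toℕ v ≡ s t × s t ⊓ toℕ (opposite v) ≡ s t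
    both t = +-tight-≤ (m⊓n≤m (s t) _) (m⊓n≤m (s t) _)
      (sum-tight-≤ (truncated≤ _ _) (trans (sym (degree-O v)) (trans deg≡D (sym (2*sum s)))) t)

toℕ+opposite : ∀ {n} (v : Fin n) → suc (toℕ v + toℕ (opposite v)) ≡ n
toℕ+opposite v = trans (cong (suc (toℕ v) +_) (opposite-prop v)) (m+[n∸m]≡n (toℕ<n v))

2*n+1≡suc[n+n] : ∀ n → 2 * n + 1 ≡ suc (n + n)
2*n+1≡suc[n+n] n = trans (+-comm (2 * n) 1) (cong (λ m → suc (n + m)) (+-identityʳ n))

lemma2p9 : ∀ (l : ℕ) → .{{NonZero l}} → (s : OrderedString l) →
    let k = maximum s
        K = O (2 * k + 1) s
        D = 2 * (∑[ j < l ] s j)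
    in IsKyleGraph s K
     × IsMaximumPossibleDegree s D
     × Δ K ≡ D
     × ∃! _≡_ (λ v → degree K v ≡ D)
lemma2p9 l s = isKyle , isMax , ΔK≡D , centre , centre-degree , unique
  where
  k = maximum s
  N = 2 * k + 1
  K = O N s
  D = 2 * sum s

  k<N : k < N
  k<N = subst (k <_) (sym (2*n+1≡suc[n+n] k)) (s≤s (m≤m+n k k))

  centre : Fin N
  centre = fromℕ< k<N

  toℕ-centre : toℕ centre ≡ k
  toℕ-centre = toℕ-fromℕ< k<N

  toℕ-opposite-centre : toℕ (opposite centre) ≡ k
  toℕ-opposite-centre = +-cancelˡ-≡ k _ _ (suc-injective (begin
    suc (k + toℕ (opposite centre))           ≡⟨ cong (λ m → suc (m + toℕ (opposite centre))) toℕ-centre ⟨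
    suc (toℕ centre + toℕ (opposite centre))  ≡⟨ toℕ+opposite centre ⟩
    N                                         ≡⟨ 2*n+1≡suc[n+n] k ⟩
    suc (k + k)                               ∎))
    where open ≡-Reasoning

  centre-degree : degree K centre ≡ D
  centre-degree = degree≡D s centre
    (≤-reflexive (sym toℕ-centre)) (≤-reflexive (sym toℕ-opposite-centre))

  unique : ∀ {v} → degree K v ≡ D → centre ≡ v
  unique {v} deg≡D with k≤left , k≤right ← degree≡D⁻¹ s v deg≡D =
    toℕ-injective (trans toℕ-centre (proj₁ (+-tight-≤ k≤left k≤right
      (suc-injective (trans (sym (2*n+1≡suc[n+n] k)) (sym (toℕ+opposite v)))))))

  Δ≤D : ∀ n → Δ (O n s) ≤ D
  Δ≤D n = maximum-lub (degree (O n s)) (degree≤D s)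

  ΔK≡D : Δ K ≡ D
  ΔK≡D = ≤-antisym (Δ≤D N) (subst (_≤ Δ K) centre-degree (≤maximum (degree K) centre))

  isMax : IsMaximumPossibleDegree s D
  isMax = record
    { attained   = N , >-nonZero (≤-<-trans z≤n k<N) , ΔK≡D
    ; upperBound = λ n _ → Δ≤D n
    }

  N≤order : ∀ m → HasVertexOfDegree (O m s) D → N ≤ m
  N≤order m (v , deg≡D) with k≤left , k≤right ← degree≡D⁻¹ s v deg≡D = begin
    N                               ≡⟨ 2*n+1≡suc[n+n] k ⟩
    suc (k + k)                     ≤⟨ s≤s (+-mono-≤ k≤left k≤right) ⟩
    suc (toℕ v + toℕ (opposite v))  ≡⟨ toℕ+opposite v ⟩
    m                               ∎
    where open ≤-Reasoning

  isKyle : IsKyleGraph s K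
  isKyle = record
    { isOrnated     = refl
    ; maxDegree     = D
    ; isMaximum     = isMax
    ; hasVertex     = centre , centre-degree
    ; smallestOrder = N≤order
    }
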